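{- The index of groups is $[L_n:H_n]=12$ and the quotient $L_n/H_n=A_4.$
   Context: Let $\mathcal{T}$ be the rooted $3$-ary tree whose vertices are words over $X=\{0,1,2\}$, and $\mathcal{T}_n$ its truncation at level $n$. Via sections, $\mathrm{Aut}(\mathcal{T}_n)\cong(\mathrm{Aut}(\mathcal{T}_{n-1})^3)\rtimes S_3$, and an element is written $(\sigma_0,\sigma_1,\sigma_2)\pi$ with $\sigma_i\in\mathrm{Aut}(\mathcal{T}_{n-1})$ and $\pi\in S_3$. $\mathrm{Aut}(\mathcal{T}_{n-1})$ is embedded in $\mathrm{Aut}(\mathcal{T}_n)$ by $\sigma\mapsto(\sigma,\mathrm{id},\mathrm{id})$. Define recursively $x_1=(0,1,2)$, $y_1=(0,1)$, $z_1=\mathrm{id}$ in $S_3=\mathrm{Aut}(\mathcal{T}_1)$, and for $n\ge2$: $x_n=(\mathrm{id},\mathrm{id},x_{n-1})(0,1,2)$, $y_n=(\mathrm{id},y_{n-1},x_{n-1})(0,1)$, $z_n=(y_{n-1},y_{n-1},x_{n-1})$. Let $L_0$ be trivial, $L_n=\langle x_n,z_n,L_{n-1}\rangle$, and $H_n=\langle L_{n-1}\rangle^{L_n}$ the normal closure of $L_{n-1}$ in $L_n$, which equals $L_{n-1}\times L_{n-1}^{x_n}\times L_{n-1}^{x_n^2}$.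
   Formalization: The theorem is stated for n ≥ 2: for n = 1 the group L_1 = ⟨(0,1,2)⟩ has order 3 and H_1 is trivial, so the index is 3 and the quotient is cyclic of order 3, not A_4. -}

module Defs where

open import Data.Nat using (ℕ; zero; suc; _<_; _>_; _%_)
open import Data.Fin using (Fin; zero; suc) renaming (_<_ to _<ᶠ_; _>_ to _>ᶠ_)
open import Data.Fin.Properties using (_<?_)
open import Data.Vec using (Vec; lookup; tabulate)
open import Data.List using (List; length; filter; concatMap; map)
open import Data.List using () renaming (allFin to allFinL)
open import Data.Product using (Σ; _×_; _,_; ∃)
open import Data.Sum using (_⊎_)
open import Data.Unit using (⊤; tt)
open import Relation.Nullary.Decidable using (_×-dec_)
open import Relation.Binary.PropositionalEquality using (_≡_)

data S3 : Set where
  e c c² t₀₁ t₀₂ t₁₂ : S3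

app : S3 → Fin 3 → Fin 3
app e   x = x
app c   zero = suc zero
app c   (suc zero) = suc (suc zero)
app c   (suc (suc zero)) = zero
app c²  zero = suc (suc zero)
app c²  (suc zero) = zero
app c²  (suc (suc zero)) = suc zero
app t₀₁ zero = suc zero
app t₀₁ (suc zero) = zero
app t₀₁ (suc (suc zero)) = suc (suc zero)
app t₀₂ zero = suc (suc zero)
app t₀₂ (suc zero) = suc zero
app t₀₂ (suc (suc zero)) = zero
app t₁₂ zero = zero
app t₁₂ (suc zero) = suc (suc zero)
app t₁₂ (suc (suc zero)) = suc zero

-- the permutation with 0 ↦ a, 1 ↦ b (the image of 2 is then forced);
-- the three non-injective inputs never occur below.
fromImages : Fin 3 → Fin 3 → S3
fromImages zero             (suc zero)       = e
fromImages zero             (suc (suc zero)) = t₁₂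
fromImages (suc zero)       zero             = t₀₁
fromImages (suc zero)       (suc (suc zero)) = c
fromImages (suc (suc zero)) zero             = c²
fromImages (suc (suc zero)) (suc zero)       = t₀₂
fromImages _                _                = e

_∘₃_ : S3 → S3 → S3
p ∘₃ q = fromImages (app p (app q zero)) (app p (app q (suc zero)))

inv₃ : S3 → S3
inv₃ e = e
inv₃ c = c²
inv₃ c² = c
inv₃ t₀₁ = t₀₁
inv₃ t₀₂ = t₀₂
inv₃ t₁₂ = t₁₂

-- Aut(𝒯ₙ) via sections: Aut(𝒯₀) is trivial and
-- Aut(𝒯ₙ₊₁) ≅ Aut(𝒯ₙ)³ ⋊ S₃.  The element (σ₀,σ₁,σ₂)π is the
-- automorphism acting by  g(x w) = π(x) σₓ(w)  (section σₓ at vertex x,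
-- root permutation π).

record Wr (A : Set) : Set where
  constructor ⟪_,_,_⟫_
  field
    s₀ s₁ s₂ : A
    perm     : S3
open Wr public

Aut : ℕ → Set
Aut zero    = ⊤
Aut (suc n) = Wr (Aut n)

sec : ∀ {A} → Wr A → Fin 3 → A
sec g zero             = s₀ g
sec g (suc zero)       = s₁ g
sec g (suc (suc zero)) = s₂ g

idA : (n : ℕ) → Aut n
idA zero    = tt
idA (suc n) = ⟪ idA n , idA n , idA n ⟫ e

-- composition (g · h)(w) = g (h w):
-- (σ)π · (τ)ρ = (σ_{ρ(x)} τₓ)ₓ (π ρ)
mulA : (n : ℕ) → Aut n → Aut n → Aut n
mulA zero    _ _ = tt
mulA (suc n) g h =
  ⟪ mulA n (sec g (app (perm h) zero)) (s₀ h)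
  , mulA n (sec g (app (perm h) (suc zero))) (s₁ h)
  , mulA n (sec g (app (perm h) (suc (suc zero)))) (s₂ h)
  ⟫ (perm g ∘₃ perm h)

invA : (n : ℕ) → Aut n → Aut n
invA zero    _ = tt
invA (suc n) g =
  ⟪ invA n (sec g (app (inv₃ (perm g)) zero))
  , invA n (sec g (app (inv₃ (perm g)) (suc zero)))
  , invA n (sec g (app (inv₃ (perm g)) (suc (suc zero))))
  ⟫ inv₃ (perm g)

ι : (n : ℕ) → Aut n → Aut (suc n)
ι n σ = ⟪ σ , idA n , idA n ⟫ e

data ⟨_⟩ {n : ℕ} (S : Aut n → Set) : Aut n → Set where
  gen : ∀ {g} → S g → ⟨ S ⟩ g
  one : ⟨ S ⟩ (idA n)
  mul : ∀ {g h} → ⟨ S ⟩ g → ⟨ S ⟩ h → ⟨ S ⟩ (mulA n g h)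
  inv : ∀ {g} → ⟨ S ⟩ g → ⟨ S ⟩ (invA n g)

-- The generators.  Indexing shift:  𝕩 n = x_{n+1}, 𝕪 n = y_{n+1},
-- 𝕫 n = z_{n+1}, all elements of Aut(𝒯_{n+1}).

𝕩 : (n : ℕ) → Aut (suc n)
𝕩 zero    = ⟪ tt , tt , tt ⟫ c
𝕩 (suc n) = ⟪ idA (suc n) , idA (suc n) , 𝕩 n ⟫ c

𝕪 : (n : ℕ) → Aut (suc n)
𝕪 zero    = ⟪ tt , tt , tt ⟫ t₀₁
𝕪 (suc n) = ⟪ idA (suc n) , 𝕪 n , 𝕩 n ⟫ t₀₁

𝕫 : (n : ℕ) → Aut (suc n)
𝕫 zero    = idA 1
𝕫 (suc n) = ⟪ 𝕪 n , 𝕪 n , 𝕩 n ⟫ e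

L : (n : ℕ) → Aut n → Set
L zero    = ⟨ (λ _ → Data.Empty.⊥) ⟩
  where import Data.Empty
L (suc n) = ⟨ (λ g → g ≡ 𝕩 n ⊎ g ≡ 𝕫 n ⊎ Σ (Aut n) (λ h → L n h × g ≡ ι n h)) ⟩

-- Hₙ = normal closure of Lₙ₋₁ in Lₙ (n ≥ 1): the subgroup generated by all
-- conjugates k ι(h) k⁻¹ with k ∈ Lₙ, h ∈ Lₙ₋₁.  (H₀ := trivial, unused.)
H : (n : ℕ) → Aut n → Set
H zero = ⟨ (λ _ → Data.Empty.⊥) ⟩
  where import Data.Empty
H (suc n) = ⟨ (λ g → Σ (Aut (suc n)) λ k → Σ (Aut n) λ h →
          L (suc n) k × L n h
          × g ≡ mulA (suc n) (mulA (suc n) k (ι n h)) (invA (suc n) k)) ⟩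

IndexIs : {n : ℕ} → (Aut n → Set) → (Aut n → Set) → ℕ → Set
IndexIs {n} G K m =
  Σ (Fin m → Aut n) λ r →
    (∀ i → G (r i))
  × (∀ g → G g → ∃ λ i → K (mulA n (invA n (r i)) g))
  × (∀ i j → K (mulA n (invA n (r i)) (r j)) → i ≡ j)

Perm4 : Set
Perm4 = Vec (Fin 4) 4

_·₄_ : Perm4 → Perm4 → Perm4
u ·₄ v = tabulate (λ i → lookup u (lookup v i))

IsPerm4 : Perm4 → Set
IsPerm4 v = ∀ i j → lookup v i ≡ lookup v j → i ≡ j

inversions : Perm4 → ℕ
inversions v =
  length (filter (λ p → Data.Product.proj₁ p <? Data.Product.proj₂ p
                        ×-dec lookup v (Data.Product.proj₂ p) <? lookup v (Data.Product.proj₁ p))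
                 (concatMap (λ i → map (λ j → (i , j)) (allFinL 4)) (allFinL 4)))
  where import Data.Product

InA4 : Perm4 → Set
InA4 v = IsPerm4 v × inversions v % 2 ≡ 0

-- L/K ≅ A₄ (K normal in L): a map φ from L to A₄ that is well defined
-- and injective on cosets, multiplicative, and onto A₄; i.e. an
-- isomorphism of the quotient group L/K onto A₄.
QuotientIsoA4 : {n : ℕ} → (Aut n → Set) → (Aut n → Set) → Set
QuotientIsoA4 {n} G K =
  Σ (Aut n → Perm4) λ φ →
    (∀ g → G g → InA4 (φ g))
  × (∀ g h → G g → G h → K (mulA n (invA n g) h) → φ g ≡ φ h)
  × (∀ g h → G g → G h → φ g ≡ φ h → K (mulA n (invA n g) h))
  × (∀ g h → G g → G h → φ (mulA n g h) ≡ φ g ·₄ φ h)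
  × (∀ a → InA4 a → ∃ λ g → G g × φ g ≡ a)

{-# OPTIONS --safe #-}

-- Let Mₙ = ⟨Lₙ , yₙ⟩, so M₁ = S₃.  Writing sgn for the sign of the root permutation, one has
--   Mₙ = { (σ₀,σ₁,σ₂)π : σᵢ ∈ Mₙ₋₁ , sgn σ₀ sgn σ₁ sgn σ₂ = sgn π }  for n ≥ 2,
--   Lₙ = { g ∈ Mₙ : sgn g = 1 }                                      for n ≥ 1.
-- For n ≥ 2 the signature (sgn σ₀, sgn σ₁, sgn σ₂)π is a homomorphism on Aut(𝒯ₙ) whose kernel
-- in Lₙ is Lₙ₋₁ × Lₙ₋₁ × Lₙ₋₁ = Hₙ, and it maps Lₙ onto the group of even sign changes extended
-- by the 3-cycles.  That group is the rotation group of the tetrahedron whose vertices are the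
-- four even sign vectors of the cube.
module Submission where

open import Defs
open import Algebra.Bundles using (CommutativeRing)
open import Data.Bool using (Bool; true; false; _xor_)
import Algebra.Properties.CommutativeSemigroup as CommutativeSemigroupProperties
open import Data.Bool.Properties using (xor-∧-commutativeRing; xor-identityʳ) renaming (_≟_ to _≟ᵇ_)
open import Data.Fin using (Fin; zero; suc; remQuot; combine)
open import Data.Fin.Properties using (all?; any?; remQuot-combine) renaming (_≟_ to _≟ᶠ_)
open import Data.Nat using (ℕ; zero; suc; _≥_; s≤s; _%_)
open import Data.Nat.Properties using () renaming (_≟_ to _≟ⁿ_)
open import Data.Product using (∃; _×_; _,_; proj₁; proj₂; uncurry)
open import Data.Sum using (inj₁; inj₂)
open import Data.Unit using (⊤; tt)
open import Data.Vec using ([]; _∷_; lookup; tabulate)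
open import Data.Vec.Properties using (≡-dec)
open import Relation.Nullary using (Dec)
open import Relation.Nullary.Decidable using (map′; toWitness; _×-dec_; _→-dec_)
open import Relation.Unary using (Decidable)
open import Relation.Binary.PropositionalEquality
  using (_≡_; refl; sym; trans; cong; cong₂; subst; module ≡-Reasoning)
open ≡-Reasoning

-- Decision by exhaustion over signs, permutations and signatures.

∀Bool? : {P : Bool → Set} → Decidable P → Dec (∀ b → P b)
∀Bool? P? = map′ (λ { (f , t) false → f ; (f , t) true → t }) (λ h → h false , h true)
  (P? false ×-dec P? true)

∀S3? : {P : S3 → Set} → Decidable P → Dec (∀ p → P p)
∀S3? P? = map′
  (λ { (p₀ , p₁ , p₂ , p₃ , p₄ , p₅) → λ { e → p₀ ; c → p₁ ; c² → p₂ ; t₀₁ → p₃ ; t₀₂ → p₄ ; t₁₂ → p₅ } })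
  (λ h → h e , h c , h c² , h t₀₁ , h t₀₂ , h t₁₂)
  (P? e ×-dec P? c ×-dec P? c² ×-dec P? t₀₁ ×-dec P? t₀₂ ×-dec P? t₁₂)

∀Wr? : {P : Wr Bool → Set} → Decidable P → Dec (∀ w → P w)
∀Wr? P? = map′ (λ h w → h (s₀ w) (s₁ w) (s₂ w) (perm w)) (λ h a b d p → h (⟪ a , b , d ⟫ p))
  (∀Bool? λ a → ∀Bool? λ b → ∀Bool? λ d → ∀S3? λ p → P? (⟪ a , b , d ⟫ p))

-- The symmetric group S₃

app-∘ : ∀ p q x → app (p ∘₃ q) x ≡ app p (app q x)
app-∘ = toWitness {a? = ∀S3? λ p → ∀S3? λ q → all? λ x → app (p ∘₃ q) x ≟ᶠ app p (app q x)} _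

app-invˡ : ∀ p x → app (inv₃ p) (app p x) ≡ x
app-invˡ = toWitness {a? = ∀S3? λ p → all? λ x → app (inv₃ p) (app p x) ≟ᶠ x} _

app-invʳ : ∀ p x → app p (app (inv₃ p) x) ≡ x
app-invʳ = toWitness {a? = ∀S3? λ p → all? λ x → app p (app (inv₃ p) x) ≟ᶠ x} _

∘₃-identityʳ : ∀ p → p ∘₃ e ≡ p
∘₃-identityʳ e   = refl
∘₃-identityʳ c   = refl
∘₃-identityʳ c²  = refl
∘₃-identityʳ t₀₁ = refl
∘₃-identityʳ t₀₂ = refl
∘₃-identityʳ t₁₂ = refl

-- `p ∘₃ e` unfolds to `fromImages` at the images of 0 and 1 under `p`, so these two values
-- determine `p`.
app-injective : ∀ {p q} → (∀ x → app p x ≡ app q x) → p ≡ q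
app-injective {p} {q} p≗q = trans (sym (∘₃-identityʳ p))
  (trans (cong₂ fromImages (p≗q zero) (p≗q (suc zero))) (∘₃-identityʳ q))

∘₃-identityˡ : ∀ p → e ∘₃ p ≡ p
-- `e ∘₃ p` and `p ∘₃ e` reduce to the same `fromImages` expression.
∘₃-identityˡ = ∘₃-identityʳ

∘₃-inverseˡ : ∀ p → inv₃ p ∘₃ p ≡ e
∘₃-inverseˡ p = app-injective λ x → trans (app-∘ (inv₃ p) p x) (app-invˡ p x)

∘₃-cancelˡ : ∀ p q → p ∘₃ (inv₃ p ∘₃ q) ≡ q
∘₃-cancelˡ p q = app-injective λ x → begin
  app (p ∘₃ (inv₃ p ∘₃ q)) x        ≡⟨ app-∘ p (inv₃ p ∘₃ q) x ⟩
  app p (app (inv₃ p ∘₃ q) x)       ≡⟨ cong (app p) (app-∘ (inv₃ p) q x) ⟩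
  app p (app (inv₃ p) (app q x))    ≡⟨ app-invʳ p (app q x) ⟩
  app q x                           ∎

parity : S3 → Bool
parity e   = false
parity c   = false
parity c²  = false
parity t₀₁ = true
parity t₀₂ = true
parity t₁₂ = true

parity-∘ : ∀ p q → parity (p ∘₃ q) ≡ parity p xor parity q
parity-∘ = toWitness {a? = ∀S3? λ p → ∀S3? λ q → parity (p ∘₃ q) ≟ᵇ (parity p xor parity q)} _

-- The group Aut(𝒯ₙ)

wr-≡ : ∀ {A} {g h : Wr A} → (∀ x → sec g x ≡ sec h x) → perm g ≡ perm h → g ≡ h
wr-≡ {g = ⟪ _ , _ , _ ⟫ _} {h = ⟪ _ , _ , _ ⟫ _} secs refl
  with refl ← secs zero | refl ← secs (suc zero) | refl ← secs (suc (suc zero)) = refl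

sec-id : ∀ n x → sec (idA (suc n)) x ≡ idA n
sec-id n zero             = refl
sec-id n (suc zero)       = refl
sec-id n (suc (suc zero)) = refl

sec-mul : ∀ n g h x → sec (mulA (suc n) g h) x ≡ mulA n (sec g (app (perm h) x)) (sec h x)
sec-mul n g h zero             = refl
sec-mul n g h (suc zero)       = refl
sec-mul n g h (suc (suc zero)) = refl

sec-inv : ∀ n g x → sec (invA (suc n) g) x ≡ invA n (sec g (app (inv₃ (perm g)) x))
sec-inv n g zero             = refl
sec-inv n g (suc zero)       = refl
sec-inv n g (suc (suc zero)) = refl

mulA-identityˡ : ∀ n g → mulA n (idA n) g ≡ g
mulA-identityˡ zero    g = refl
mulA-identityˡ (suc n) g = wr-≡
  (λ x → begin
    sec (mulA (suc n) (idA (suc n)) g) x                   ≡⟨ sec-mul n (idA (suc n)) g x ⟩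
    mulA n (sec (idA (suc n)) (app (perm g) x)) (sec g x)  ≡⟨ cong (λ s → mulA n s (sec g x)) (sec-id n (app (perm g) x)) ⟩
    mulA n (idA n) (sec g x)                               ≡⟨ mulA-identityˡ n (sec g x) ⟩
    sec g x                                                ∎)
  (∘₃-identityˡ (perm g))

mulA-identityʳ : ∀ n g → mulA n g (idA n) ≡ g
mulA-identityʳ zero    g = refl
mulA-identityʳ (suc n) g = wr-≡
  (λ x → begin
    sec (mulA (suc n) g (idA (suc n))) x       ≡⟨ sec-mul n g (idA (suc n)) x ⟩
    mulA n (sec g x) (sec (idA (suc n)) x)     ≡⟨ cong (mulA n (sec g x)) (sec-id n x) ⟩
    mulA n (sec g x) (idA n)                   ≡⟨ mulA-identityʳ n (sec g x) ⟩
    sec g x                                    ∎)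
  (∘₃-identityʳ (perm g))

mulA-inverseˡ : ∀ n g → mulA n (invA n g) g ≡ idA n
mulA-inverseˡ zero    g = refl
mulA-inverseˡ (suc n) g = wr-≡
  (λ x → begin
    sec (mulA (suc n) (invA (suc n) g) g) x
      ≡⟨ sec-mul n (invA (suc n) g) g x ⟩
    mulA n (sec (invA (suc n) g) (app (perm g) x)) (sec g x)
      ≡⟨ cong (λ s → mulA n s (sec g x)) (sec-inv n g (app (perm g) x)) ⟩
    mulA n (invA n (sec g (app (inv₃ (perm g)) (app (perm g) x)))) (sec g x)
      ≡⟨ cong (λ y → mulA n (invA n (sec g y)) (sec g x)) (app-invˡ (perm g) x) ⟩
    mulA n (invA n (sec g x)) (sec g x)
      ≡⟨ mulA-inverseˡ n (sec g x) ⟩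
    idA n
      ≡⟨ sec-id n x ⟨
    sec (idA (suc n)) x ∎)
  (∘₃-inverseˡ (perm g))

-- This instance of associativity is proved directly on sections: at each vertex it is the same
-- cancellation one level down. The right inverse law and the division by coset representatives rest
-- on it.
mulA-cancelˡ : ∀ n g h → mulA n g (mulA n (invA n g) h) ≡ h
mulA-cancelˡ zero    g h = refl
mulA-cancelˡ (suc n) g h = wr-≡
  (λ x → let y = app (inv₃ (perm g)) (app (perm h) x) in begin
    sec (mulA (suc n) g (mulA (suc n) (invA (suc n) g) h)) x
      ≡⟨ sec-mul n g (mulA (suc n) (invA (suc n) g) h) x ⟩
    mulA n (sec g (app (inv₃ (perm g) ∘₃ perm h) x)) (sec (mulA (suc n) (invA (suc n) g) h) x)
      ≡⟨ cong₂ (mulA n) (cong (sec g) (app-∘ (inv₃ (perm g)) (perm h) x))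
           (trans (sec-mul n (invA (suc n) g) h x)
                  (cong (λ s → mulA n s (sec h x)) (sec-inv n g (app (perm h) x)))) ⟩
    mulA n (sec g y) (mulA n (invA n (sec g y)) (sec h x))
      ≡⟨ mulA-cancelˡ n (sec g y) (sec h x) ⟩
    sec h x ∎)
  (∘₃-cancelˡ (perm g) (perm h))

mulA-inverseʳ : ∀ n g → mulA n g (invA n g) ≡ idA n
mulA-inverseʳ n g = trans (cong (mulA n g) (sym (mulA-identityʳ n (invA n g)))) (mulA-cancelˡ n g (idA n))

conj : ∀ n → Aut n → Aut n → Aut n
conj n k h = mulA n (mulA n k h) (invA n k)

invA-id : ∀ n → invA n (idA n) ≡ idA n
invA-id n = trans (sym (mulA-identityˡ n _)) (mulA-inverseʳ n (idA n))

conj-id : ∀ n k → conj n k (idA n) ≡ idA n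
conj-id n k = trans (cong (λ g → mulA n g (invA n k)) (mulA-identityʳ n k)) (mulA-inverseʳ n k)

id-conj : ∀ n h → conj n (idA n) h ≡ h
id-conj n h = trans (cong₂ (mulA n) (mulA-identityˡ n h) (invA-id n)) (mulA-identityʳ n h)

-- Signatures

-- The product of the signed permutation group on three coordinates, with `true` for the sign -1 and
-- `xor` for multiplication of signs. The convention for sections is that of `mulA`.
mulₛ : Wr Bool → Wr Bool → Wr Bool
mulₛ v w =
  ⟪ sec v (app (perm w) zero) xor s₀ w
  , sec v (app (perm w) (suc zero)) xor s₁ w
  , sec v (app (perm w) (suc (suc zero))) xor s₂ w
  ⟫ (perm v ∘₃ perm w)

odd : ∀ {A} → Wr A → Bool
odd g = parity (perm g)

sig : ∀ {A} → Wr (Wr A) → Wr Bool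
sig g = ⟪ odd (s₀ g) , odd (s₁ g) , odd (s₂ g) ⟫ perm g

sec-sig : ∀ {A} (g : Wr (Wr A)) x → sec (sig g) x ≡ odd (sec g x)
sec-sig g zero             = refl
sec-sig g (suc zero)       = refl
sec-sig g (suc (suc zero)) = refl

1ₛ : Wr Bool
1ₛ = ⟪ false , false , false ⟫ e

total : Wr Bool → Bool
total w = s₀ w xor (s₁ w xor s₂ w)

total-mul : ∀ v w → total (mulₛ v w) ≡ total v xor total w
total-mul = toWitness {a? = ∀Wr? λ v → ∀Wr? λ w → total (mulₛ v w) ≟ᵇ (total v xor total w)} _

-- `false` exactly when the product of the three signs equals the sign of the permutation, which is
-- the condition defining Mₙ.
defect : Wr Bool → Bool
defect w = total w xor parity (perm w)

-- Both summands are homomorphisms to the commutative group of signs, hence so is their sum.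
defect-mul : ∀ v w → defect (mulₛ v w) ≡ defect v xor defect w
defect-mul v w = trans
  (cong₂ _xor_ (total-mul v w) (parity-∘ (perm v) (perm w)))
  (interchange (total v) (total w) (parity (perm v)) (parity (perm w)))
  where open CommutativeSemigroupProperties
          (CommutativeRing.+-commutativeSemigroup xor-∧-commutativeRing)

module _ (n : ℕ) where
  private
    N : ℕ
    N = suc (suc n)

  sig-mul : ∀ (g h : Aut N) → sig (mulA N g h) ≡ mulₛ (sig g) (sig h)
  sig-mul g h = wr-≡ {g = sig (mulA N g h)}
    (λ { zero → at zero ; (suc zero) → at (suc zero) ; (suc (suc zero)) → at (suc (suc zero)) }) refl
    where
    at : ∀ x → parity (perm (sec g (app (perm h) x)) ∘₃ perm (sec h x)) ≡ sec (sig g) (app (perm h) x) xor odd (sec h x)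
    at x = trans (parity-∘ (perm (sec g (app (perm h) x))) (perm (sec h x)))
                 (cong (_xor odd (sec h x)) (sym (sec-sig g (app (perm h) x))))

  -- Group laws for signatures are transported from Aut(𝒯ₙ) along `sig-mul`; the same device proves
  -- the next lemmas.
  mulₛ-sig-1ₛ : ∀ (g : Aut N) → mulₛ (sig g) 1ₛ ≡ sig g
  mulₛ-sig-1ₛ g = trans (sym (sig-mul g (idA N))) (cong sig (mulA-identityʳ N g))

  sig-≡⇒ : ∀ (g h : Aut N) → sig g ≡ sig h → sig (mulA N (invA N g) h) ≡ 1ₛ
  sig-≡⇒ g h g≡h = begin
    sig (mulA N (invA N g) h)        ≡⟨ sig-mul (invA N g) h ⟩
    mulₛ (sig (invA N g)) (sig h)    ≡⟨ cong (mulₛ (sig (invA N g))) g≡h ⟨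
    mulₛ (sig (invA N g)) (sig g)    ≡⟨ sig-mul (invA N g) g ⟨
    sig (mulA N (invA N g) g)        ≡⟨ cong sig (mulA-inverseˡ N g) ⟩
    1ₛ                               ∎

  sig-≡⇐ : ∀ (g h : Aut N) → sig (mulA N (invA N g) h) ≡ 1ₛ → sig g ≡ sig h
  sig-≡⇐ g h p = begin
    sig g                                       ≡⟨ mulₛ-sig-1ₛ g ⟨
    mulₛ (sig g) 1ₛ                             ≡⟨ cong (mulₛ (sig g)) p ⟨
    mulₛ (sig g) (sig (mulA N (invA N g) h))    ≡⟨ sig-mul g (mulA N (invA N g) h) ⟨
    sig (mulA N g (mulA N (invA N g) h))        ≡⟨ cong sig (mulA-cancelˡ N g h) ⟩
    sig h                                       ∎

  sig-inv : ∀ (g : Aut N) → sig g ≡ 1ₛ → sig (invA N g) ≡ 1ₛ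
  sig-inv g p = trans (cong sig (sym (mulA-identityʳ N (invA N g)))) (sig-≡⇒ g (idA N) p)

  sig-conj : ∀ (k h : Aut N) → sig h ≡ 1ₛ → sig (conj N k h) ≡ 1ₛ
  sig-conj k h p = begin
    sig (conj N k h)                               ≡⟨ sig-mul (mulA N k h) (invA N k) ⟩
    mulₛ (sig (mulA N k h)) (sig (invA N k))       ≡⟨ cong (λ s → mulₛ s (sig (invA N k))) (sig-mul k h) ⟩
    mulₛ (mulₛ (sig k) (sig h)) (sig (invA N k))   ≡⟨ cong (λ s → mulₛ (mulₛ (sig k) s) (sig (invA N k))) p ⟩
    mulₛ (mulₛ (sig k) 1ₛ) (sig (invA N k))        ≡⟨ cong (λ s → mulₛ s (sig (invA N k))) (mulₛ-sig-1ₛ k) ⟩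
    mulₛ (sig k) (sig (invA N k))                  ≡⟨ sig-mul k (invA N k) ⟨
    sig (mulA N k (invA N k))                      ≡⟨ cong sig (mulA-inverseʳ N k) ⟩
    1ₛ                                             ∎

-- The groups Mₙ

-- Indexing shift as for 𝕩, 𝕪, 𝕫:  M n is Mₙ₊₁ ⊆ Aut(𝒯ₙ₊₁).
M : ∀ n → Aut (suc n) → Set
M zero    g = ⊤
M (suc n) g = (∀ x → M n (sec g x)) × defect (sig g) ≡ false

M-intro : ∀ n (g : Aut (suc (suc n))) → M n (s₀ g) → M n (s₁ g) → M n (s₂ g) → defect (sig g) ≡ false → M (suc n) g
M-intro n g m₀ m₁ m₂ d = (λ { zero → m₀ ; (suc zero) → m₁ ; (suc (suc zero)) → m₂ }) , d

M-id : ∀ n → M n (idA (suc n))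
M-id zero    = tt
M-id (suc n) = M-intro n (idA (suc (suc n))) (M-id n) (M-id n) (M-id n) refl

M-mul : ∀ n g h → M n g → M n h → M n (mulA (suc n) g h)
M-mul zero    _ _ _ _ = tt
M-mul (suc n) g h (mg , dg) (mh , dh) =
  (λ x → subst (M n) (sym (sec-mul (suc n) g h x)) (M-mul n (sec g (app (perm h) x)) (sec h x) (mg (app (perm h) x)) (mh x))) ,
  (begin
    defect (sig (mulA (suc (suc n)) g h))  ≡⟨ cong defect (sig-mul n g h) ⟩
    defect (mulₛ (sig g) (sig h))          ≡⟨ defect-mul (sig g) (sig h) ⟩
    defect (sig g) xor defect (sig h)      ≡⟨ cong₂ _xor_ dg dh ⟩
    false                                  ∎)

M-inv : ∀ n g → M n g → M n (invA (suc n) g)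
M-inv zero    _ _ = tt
M-inv (suc n) g (mg , dg) =
  (λ x → subst (M n) (sym (sec-inv (suc n) g x)) (M-inv n (sec g (app (inv₃ (perm g)) x)) (mg (app (inv₃ (perm g)) x)))) ,
  (begin
    -- The defect of `g` is `false`, so adding it changes nothing and completes the product of `g`
    -- with its inverse.
    defect (sig g⁻¹)                                 ≡⟨ cong (_xor defect (sig g⁻¹)) dg ⟨
    defect (sig g) xor defect (sig g⁻¹)              ≡⟨ defect-mul (sig g) (sig g⁻¹) ⟨
    defect (mulₛ (sig g) (sig g⁻¹))                  ≡⟨ cong defect (sig-mul n g g⁻¹) ⟨
    defect (sig (mulA (suc (suc n)) g g⁻¹))          ≡⟨ cong (λ k → defect (sig k)) (mulA-inverseʳ (suc (suc n)) g) ⟩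
    false                                            ∎)
  where g⁻¹ = invA (suc (suc n)) g

-- The generators, and the sign conditions satisfied by Lₙ and Hₙ.

perm-𝕩 : ∀ n → perm (𝕩 n) ≡ c
perm-𝕩 zero    = refl
perm-𝕩 (suc n) = refl

perm-𝕪 : ∀ n → perm (𝕪 n) ≡ t₀₁
perm-𝕪 zero    = refl
perm-𝕪 (suc n) = refl

sig-𝕩 : ∀ n → sig (𝕩 (suc n)) ≡ ⟪ false , false , false ⟫ c
sig-𝕩 n rewrite perm-𝕩 n = refl

sig-𝕪 : ∀ n → sig (𝕪 (suc n)) ≡ ⟪ false , true , false ⟫ t₀₁
sig-𝕪 n rewrite perm-𝕪 n | perm-𝕩 n = refl

sig-𝕫 : ∀ n → sig (𝕫 (suc n)) ≡ ⟪ true , true , false ⟫ e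
sig-𝕫 n rewrite perm-𝕪 n | perm-𝕩 n = refl

M-𝕩 : ∀ n → M n (𝕩 n)
M-𝕩 zero    = tt
M-𝕩 (suc n) = M-intro n (𝕩 (suc n)) (M-id n) (M-id n) (M-𝕩 n) (cong defect (sig-𝕩 n))

M-𝕪 : ∀ n → M n (𝕪 n)
M-𝕪 zero    = tt
M-𝕪 (suc n) = M-intro n (𝕪 (suc n)) (M-id n) (M-𝕪 n) (M-𝕩 n) (cong defect (sig-𝕪 n))

M-𝕫 : ∀ n → M n (𝕫 n)
M-𝕫 zero    = tt
M-𝕫 (suc n) = M-intro n (𝕫 (suc n)) (M-𝕪 n) (M-𝕪 n) (M-𝕩 n) (cong defect (sig-𝕫 n))

odd-𝕩 : ∀ n → odd (𝕩 n) ≡ false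
odd-𝕩 n = cong parity (perm-𝕩 n)

odd-𝕫 : ∀ n → odd (𝕫 n) ≡ false
odd-𝕫 zero    = refl
odd-𝕫 (suc n) = refl

-- The explicit description of Lₙ₊₁ by signs; `L⇒L⁺` and `L⁺⇒L` are the two inclusions.
L⁺ : ∀ n → Aut (suc n) → Set
L⁺ n g = M n g × odd g ≡ false

sig-ι : ∀ n (h : Aut (suc n)) → odd h ≡ false → sig (ι (suc n) h) ≡ 1ₛ
sig-ι n h = cong (λ b → ⟪ b , false , false ⟫ e)

-- The root permutation of `ι h` is trivial, so the sign condition asks that `h` be even, which `L⁺`
-- provides.
M-ι : ∀ n h → L⁺ n h → M (suc n) (ι (suc n) h)
M-ι n h (mh , odd-h) = M-intro n (ι (suc n) h) mh (M-id n) (M-id n) (cong defect (sig-ι n h odd-h))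

L⇒L⁺ : ∀ n {g} → L (suc n) g → L⁺ n g
L⇒L⁺ n       (gen (inj₁ refl))        = M-𝕩 n , odd-𝕩 n
L⇒L⁺ n       (gen (inj₂ (inj₁ refl))) = M-𝕫 n , odd-𝕫 n
L⇒L⁺ zero    (gen (inj₂ (inj₂ (h , l , refl)))) = tt , refl
L⇒L⁺ (suc n) (gen (inj₂ (inj₂ (h , l , refl)))) = M-ι n h (L⇒L⁺ n l) , refl
L⇒L⁺ n one = M-id n , refl
L⇒L⁺ n (mul {g} {h} k l) =
  let mg , dg = L⇒L⁺ n k
      mh , dh = L⇒L⁺ n l
  in M-mul n g h mg mh , trans (parity-∘ (perm g) (perm h)) (cong₂ _xor_ dg dh)
L⇒L⁺ n (inv {g} l) = let mg , dg = L⇒L⁺ n l in M-inv n g mg , parity-inv (perm g) dg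
  where
  parity-inv : ∀ p → parity p ≡ false → parity (inv₃ p) ≡ false
  parity-inv e  _ = refl
  parity-inv c  _ = refl
  parity-inv c² _ = refl

-- The kernel of the signature in Mₙ₊₂, which will turn out to be Hₙ₊₂. Its elements fix the first
-- level, and their sections are even elements of Mₙ₊₁.
H⁺ : ∀ n → Aut (suc (suc n)) → Set
H⁺ n g = M (suc n) g × sig g ≡ 1ₛ

-- An even `h` gives `ι h` trivial signature, and the kernel of a homomorphism is closed under
-- conjugation.
H⇒H⁺ : ∀ n {g} → H (suc (suc n)) g → H⁺ n g
H⇒H⁺ n (gen (k , h , lk , lh , refl)) =
  let N : ℕ
      N      = suc (suc n)
      ιh     = ι (suc n) h
      mk , _ = L⇒L⁺ (suc n) lk
      l⁺     = L⇒L⁺ n lh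
  in M-mul (suc n) (mulA N k ιh) (invA N k) (M-mul (suc n) k ιh mk (M-ι n h l⁺)) (M-inv (suc n) k mk)
   , sig-conj n k ιh (sig-ι n h (proj₂ l⁺))
H⇒H⁺ n one = M-id (suc n) , refl
H⇒H⁺ n (mul {g} {h} k l) =
  let mg , pg = H⇒H⁺ n k
      mh , ph = H⇒H⁺ n l
  in M-mul (suc n) g h mg mh , trans (sig-mul n g h) (cong₂ mulₛ pg ph)
H⇒H⁺ n (inv {g} l) = let mg , pg = H⇒H⁺ n l in M-inv (suc n) g mg , sig-inv n g pg

H⇒L : ∀ n {g} → H (suc n) g → L (suc n) g
H⇒L n (gen (k , h , lk , lh , refl)) = mul (mul lk (gen (inj₂ (inj₂ (h , lh , refl))))) (inv lk)
H⇒L n one       = one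
H⇒L n (mul k l) = mul (H⇒L n k) (H⇒L n l)
H⇒L n (inv l)   = inv (H⇒L n l)

L-𝕩 : ∀ n → L (suc n) (𝕩 n)
L-𝕩 n = gen (inj₁ refl)

-- The product Lₙ₋₁ × Lₙ₋₁ × Lₙ₋₁ inside Hₙ.

module _ (n : ℕ) where
  private
    N : ℕ
    N = suc (suc n)
    x₀ = 𝕩 (suc n)
    1ₙ = idA (suc n)
    _·_ = mulA (suc n)

  -- At the root x sends 0 to 1, and its section at 0 is trivial, so `h` is moved without being
  -- conjugated. The nontrivial section of x, at vertex 2, only conjugates an identity.
  place₁ : ∀ h → conj N x₀ (ι (suc n) h) ≡ ⟪ 1ₙ , h , 1ₙ ⟫ e
  place₁ h = wr-≡
    (λ { zero → conj-id (suc n) (𝕩 n) ; (suc zero) → id-conj (suc n) h ; (suc (suc zero)) → conj-id (suc n) 1ₙ })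
    refl

  -- Likewise x² sends 0 to 2, and its section at 0 is a product of two identities.
  place₂ : ∀ h → conj N (mulA N x₀ x₀) (ι (suc n) h) ≡ ⟪ 1ₙ , 1ₙ , h ⟫ e
  place₂ h = wr-≡
    (λ { zero → conj-id (suc n) (𝕩 n · 1ₙ)
       ; (suc zero) → conj-id (suc n) (1ₙ · 𝕩 n)
       ; (suc (suc zero)) → trans (cong (λ k → conj (suc n) k h) (mulA-identityˡ (suc n) 1ₙ)) (id-conj (suc n) h) })
    refl

  -- The three factors are the conjugates of `ι a`, `ι b`, `ι d` by 1, x and x².
  L×L×L⇒H : ∀ {a b d} → L (suc n) a → L (suc n) b → L (suc n) d → H N (⟪ a , b , d ⟫ e)
  L×L×L⇒H {a} {b} {d} la lb ld = subst (H N) split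
    (mul (mul (gen (idA N , a , one , la , sym (id-conj N (ι (suc n) a))))
              (gen (x₀ , b , L-𝕩 (suc n) , lb , sym (place₁ b))))
         (gen (mulA N x₀ x₀ , d , mul (L-𝕩 (suc n)) (L-𝕩 (suc n)) , ld , sym (place₂ d))))
    where
    split : mulA N (mulA N (ι (suc n) a) (⟪ 1ₙ , b , 1ₙ ⟫ e)) (⟪ 1ₙ , 1ₙ , d ⟫ e) ≡ ⟪ a , b , d ⟫ e
    split = wr-≡
      (λ { zero → trans (mulA-identityʳ (suc n) (a · 1ₙ)) (mulA-identityʳ (suc n) a)
         ; (suc zero) → trans (mulA-identityʳ (suc n) (1ₙ · b)) (mulA-identityˡ (suc n) b)
         ; (suc (suc zero)) → trans (cong (_· d) (mulA-identityˡ (suc n) 1ₙ)) (mulA-identityˡ (suc n) d) })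
      refl

-- The tetrahedral group

-- The even sign vectors (δ₀ , δ₁ , δ₀ + δ₁), indexed by their first two coordinates.
bits : Fin 4 → Bool × Bool
bits zero                   = false , false
bits (suc zero)             = false , true
bits (suc (suc zero))       = true  , false
bits (suc (suc (suc zero))) = true  , true

unbits : Bool → Bool → Fin 4
unbits false false = zero
unbits false true  = suc zero
unbits true  false = suc (suc zero)
unbits true  true  = suc (suc (suc zero))

δ : Fin 4 → Fin 3 → Bool
δ q zero             = proj₁ (bits q)
δ q (suc zero)       = proj₂ (bits q)
δ q (suc (suc zero)) = uncurry _xor_ (bits q)

rot : Fin 3 → S3
rot zero             = e
rot (suc zero)       = c
rot (suc (suc zero)) = c²

rotation : Fin 4 × Fin 3 → Wr Bool
rotation (q , r) = ⟪ δ q zero , δ q (suc zero) , δ q (suc (suc zero)) ⟫ rot r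

-- The tetrahedral group, numbered by 12 = 4 · 3: an even sign vector together with a power of the
-- 3-cycle.
tetra : Fin 12 → Wr Bool
tetra i = rotation (remQuot 3 i)

bits-unbits : ∀ a b → bits (unbits a b) ≡ (a , b)
bits-unbits false false = refl
bits-unbits false true  = refl
bits-unbits true  false = refl
bits-unbits true  true  = refl

third-bit : ∀ a b d → a xor (b xor d) ≡ false → a xor b ≡ d
third-bit = toWitness {a? = ∀Bool? λ a → ∀Bool? λ b → ∀Bool? λ d →
  ((a xor (b xor d)) ≟ᵇ false) →-dec ((a xor b) ≟ᵇ d)} _

rot-surjective : ∀ p → parity p ≡ false → ∃ λ r → rot r ≡ p
rot-surjective e  _ = zero , refl
rot-surjective c  _ = suc zero , refl
rot-surjective c² _ = suc (suc zero) , refl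

-- For an even permutation, zero defect means that the signs multiply to 1. The first two then
-- determine the third, and the permutation is a power of the 3-cycle.
tetra-complete : ∀ w → defect w ≡ false → parity (perm w) ≡ false → ∃ λ i → tetra i ≡ w
tetra-complete w defect≡0 even with r , refl ← rot-surjective (perm w) even =
  combine (unbits (s₀ w) (s₁ w)) r ,
  trans (cong rotation (remQuot-combine (unbits (s₀ w) (s₁ w)) r))
    (wr-≡ (λ { zero → cong proj₁ bits≡ ; (suc zero) → cong proj₂ bits≡
             ; (suc (suc zero)) → trans (cong (uncurry _xor_) bits≡) (third-bit (s₀ w) (s₁ w) (s₂ w) total≡0) })
          refl)
  where
  bits≡ = bits-unbits (s₀ w) (s₁ w)
  total≡0 : total w ≡ false
  total≡0 = begin
    total w                        ≡⟨ xor-identityʳ (total w) ⟨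
    total w xor false              ≡⟨ cong (total w xor_) even ⟨
    defect w                       ≡⟨ defect≡0 ⟩
    false                          ∎

-- w = (ε)π acts on sign vectors by (w δ)(π x) = ε(x) + δ(x).
permute : Wr Bool → Perm4
-- Two coordinates suffice for `tetra` elements: they preserve even sign vectors, whose third
-- coordinate is forced.
permute w = tabulate λ q → unbits (image q zero) (image q (suc zero))
  where
  image : Fin 4 → Fin 3 → Bool
  image q y = let x = app (inv₃ (perm w)) y in sec w x xor δ q x

_≟ₚ_ : (u v : Perm4) → Dec (u ≡ v)
_≟ₚ_ = ≡-dec _≟ᶠ_

InA4? : Decidable InA4
InA4? v = (all? λ i → all? λ j → (lookup v i ≟ᶠ lookup v j) →-dec (i ≟ᶠ j)) ×-dec (inversions v % 2 ≟ⁿ 0)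

permute-A4 : ∀ i → InA4 (permute (tetra i))
permute-A4 = toWitness {a? = all? λ i → InA4? (permute (tetra i))} _

permute-mul : ∀ i j → permute (mulₛ (tetra i) (tetra j)) ≡ permute (tetra i) ·₄ permute (tetra j)
permute-mul = toWitness {a? = all? λ i → all? λ j →
  permute (mulₛ (tetra i) (tetra j)) ≟ₚ (permute (tetra i) ·₄ permute (tetra j))} _

permute-injective : ∀ i j → permute (tetra i) ≡ permute (tetra j) → i ≡ j
permute-injective = toWitness {a? = all? λ i → all? λ j →
  (permute (tetra i) ≟ₚ permute (tetra j)) →-dec (i ≟ᶠ j)} _

permute-onto : ∀ v → InA4 v → ∃ λ i → permute (tetra i) ≡ v
-- The vector is split into entries so that the search runs over four variables in `Fin 4`.
permute-onto (p ∷ q ∷ r ∷ s ∷ []) = toWitness {a? = all? λ p → all? λ q → all? λ r → all? λ s →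
  let v = p ∷ q ∷ r ∷ s ∷ [] in InA4? v →-dec (any? λ i → permute (tetra i) ≟ₚ v)} _ p q r s

-- Lₙ maps onto the tetrahedral group, and the sign conditions suffice.

module _ (n : ℕ) where
  private
    N : ℕ
    N = suc (suc n)

  L-onto-tetra : ∀ i → ∃ λ g → L N g × sig g ≡ tetra i
  L-onto-tetra i = let q , r = remQuot 3 i in realise q r
    where
    Realised : Wr Bool → Set
    Realised w = ∃ λ g → L N g × sig g ≡ w

    _∙_ : ∀ {v w} → Realised v → Realised w → Realised (mulₛ v w)
    (g , lg , g≡) ∙ (h , lh , h≡) = mulA N g h , mul lg lh , trans (sig-mul n g h) (cong₂ mulₛ g≡ h≡)

    x : Realised (⟪ false , false , false ⟫ c)
    x = 𝕩 (suc n) , gen (inj₁ refl) , sig-𝕩 n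

    z : Realised (⟪ true , true , false ⟫ e)
    z = 𝕫 (suc n) , gen (inj₂ (inj₁ refl)) , sig-𝕫 n

    flips : ∀ q → Realised (rotation (q , zero))
    flips zero                   = idA N , one , refl
    -- On signatures x has order 3, so `x ∙ x` serves as the inverse of `x`. This case and the next
    -- conjugate `z` by `x` and by its inverse, rotating its two sign changes to the other pairs of
    -- coordinates.
    flips (suc zero)             = (x ∙ z) ∙ (x ∙ x)
    flips (suc (suc zero))       = ((x ∙ x) ∙ z) ∙ x
    flips (suc (suc (suc zero))) = z

    rotate : ∀ {a b d} r → Realised (⟪ a , b , d ⟫ e) → Realised (⟪ a , b , d ⟫ rot r)
    rotate zero             w = w
    -- `x` has no signs, so multiplying by it on the left changes only the permutation.
    rotate (suc zero)       w = x ∙ w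
    rotate (suc (suc zero)) w = (x ∙ x) ∙ w

    realise : ∀ q r → Realised (rotation (q , r))
    realise q r = rotate r (flips q)

-- Mutual induction on the level. Dividing an element of `L⁺` by an element of Lₙ with the same
-- signature leaves an element of `H⁺`; the three sections of that lie in `L⁺` one level down.
L⁺⇒L : ∀ n {g} → L⁺ n g → L (suc n) g
H⁺⇒H : ∀ n {g} → H⁺ n g → H (suc (suc n)) g
sig-≡⇒H : ∀ n g h → M (suc n) g → M (suc n) h → sig g ≡ sig h →
          H (suc (suc n)) (mulA (suc (suc n)) (invA (suc (suc n)) g) h)

-- Trivial signature forces the root permutation `e`, and its sign components say that the sections
-- are even.
H⁺⇒H n {⟪ a , b , d ⟫ e} ((m , _) , p) = L×L×L⇒H n
  (L⁺⇒L n (m zero , cong s₀ p))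
  (L⁺⇒L n (m (suc zero) , cong s₁ p))
  (L⁺⇒L n (m (suc (suc zero)) , cong s₂ p))

sig-≡⇒H n g h mg mh eq = H⁺⇒H n
  (M-mul (suc n) (invA (suc (suc n)) g) h (M-inv (suc n) g mg) mh , sig-≡⇒ n g h eq)

-- At level 1 the even permutations are the powers of x₁.
L⁺⇒L zero {⟪ _ , _ , _ ⟫ e}  _ = one
L⁺⇒L zero {⟪ _ , _ , _ ⟫ c}  _ = L-𝕩 0
L⁺⇒L zero {⟪ _ , _ , _ ⟫ c²} _ = mul (L-𝕩 0) (L-𝕩 0)
L⁺⇒L (suc n) {g} (mg , odd-g) =
  let i , tetra≡ = tetra-complete (sig g) (proj₂ mg) odd-g
      r , lr , r≡ = L-onto-tetra n i
      N : ℕ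
      N = suc (suc n)
      h = sig-≡⇒H n r g (proj₁ (L⇒L⁺ (suc n) lr)) mg (trans r≡ tetra≡)
  -- `g` is recovered as r · (r⁻¹ g), with r⁻¹ g in Hₙ and hence in Lₙ.
  in subst (L N) (mulA-cancelˡ N r g) (mul lr (H⇒L (suc n) h))

-- The index and the quotient.

theorem3p10 : (n : ℕ) → n ≥ 2 →
    IndexIs {n} (L n) (H n) 12 × QuotientIsoA4 {n} (L n) (H n)
-- From level 2 on, the sections have root permutations, so `sig` is defined.
theorem3p10 (suc (suc n)) (s≤s (s≤s _)) =
  ( (λ i → proj₁ (L-onto-tetra n i))
  , (λ i → proj₁ (proj₂ (L-onto-tetra n i)))
  , (λ g lg → let i , i≡ = tetra-of lg
                  r , lr , r≡ = L-onto-tetra n i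
              in i , L-sig-≡⇒H lr lg (trans r≡ i≡))
  , (λ i j k → let r , lr , r≡ = L-onto-tetra n i
                   s , ls , s≡ = L-onto-tetra n j
               -- Representatives of the same coset share a signature; `permute` separates the
               -- twelve signatures.
               in permute-injective i j (cong permute (trans (sym r≡) (trans (H⇒sig-≡ r s k) s≡)))) )
  , ( (λ g → permute (sig g))
    , (λ g lg → let i , i≡ = tetra-of lg in subst (λ w → InA4 (permute w)) i≡ (permute-A4 i))
    , (λ g h lg lh k → cong permute (H⇒sig-≡ g h k))
    , (λ g h lg lh eq →
         let i , i≡ = tetra-of lg
             j , j≡ = tetra-of lh
             i≡j    = permute-injective i j (trans (cong permute i≡) (trans eq (cong permute (sym j≡))))
         in L-sig-≡⇒H lg lh (trans (sym i≡) (trans (cong tetra i≡j) j≡)))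
    , (λ g h lg lh →
         let i , i≡ = tetra-of lg
             j , j≡ = tetra-of lh
         -- Multiplicativity was checked on `tetra` indices, so both signatures are replaced by
         -- their indexed forms.
         in trans (cong permute (sig-mul n g h))
              (subst (λ w → permute (mulₛ (sig g) w) ≡ permute (sig g) ·₄ permute w) j≡
                (subst (λ w → permute (mulₛ w (tetra j)) ≡ permute w ·₄ permute (tetra j)) i≡ (permute-mul i j))))
    , (λ v a4 → let i , i≡ = permute-onto v a4
                    r , lr , r≡ = L-onto-tetra n i
                in r , lr , trans (cong permute r≡) i≡) )
  where
  N : ℕ
  N = suc (suc n)

  tetra-of : ∀ {g} → L N g → ∃ λ i → tetra i ≡ sig g
  tetra-of {g} lg = let (_ , defect≡0) , odd-g = L⇒L⁺ (suc n) lg in tetra-complete (sig g) defect≡0 odd-g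

  L-sig-≡⇒H : ∀ {g h} → L N g → L N h → sig g ≡ sig h → H N (mulA N (invA N g) h)
  L-sig-≡⇒H {g} {h} lg lh = sig-≡⇒H n g h (proj₁ (L⇒L⁺ (suc n) lg)) (proj₁ (L⇒L⁺ (suc n) lh))

  H⇒sig-≡ : ∀ g h → H N (mulA N (invA N g) h) → sig g ≡ sig h
  H⇒sig-≡ g h k = sig-≡⇐ n g h (proj₂ (H⇒H⁺ n k))
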